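{- The sets of patterns $\{112,2121\}$ and $\{121,1122\}$ are $m$-equivalent, that is, $\{112,2121\}\sim\{121,1122\}$.
   Context: A (finite, reduced) multiset is $S=1^{a_1}2^{a_2}\cdots k^{a_k}$ with $k\ge 1$ and all $a_i\ge 1$, meaning that $i$ occurs with multiplicity $a_i$. A multipermutation of $S$ is a word having exactly $a_i$ occurrences of each letter $i\in[k]=\{1,\dots,k\}$ and no other letters. A word $\pi=\pi_1\cdots\pi_n$ contains a pattern (word) $\rho=\rho_1\cdots\rho_\ell$ if there are indices $i(1)<\cdots<i(\ell)$ such that for all $a,b\in[\ell]$: $\pi_{i(a)}<\pi_{i(b)}$ iff $\rho_a<\rho_b$, and $\pi_{i(a)}>\pi_{i(b)}$ iff $\rho_a>\rho_b$; otherwise $\pi$ avoids $\rho$. For a set $P$ of patterns, $\mathrm{av}(S;P)$ is the number of multipermutations of $S$ that avoid every pattern in $P$. Two sets of patterns $P,Q$ are $m$-equivalent, written here $P\sim Q$, if $\mathrm{av}(S;P)=\mathrm{av}(S;Q)$ for every multiset $S$. -}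

module Defs where

open import Data.Fin.Base as Fin using (Fin; zero; suc; toℕ; fromℕ<)
import Data.Fin.Properties as Fin
open import Data.List.Base using (List; []; _∷_; length; lookup; filter; map; upTo; cartesianProductWith)
open import Data.List.Membership.Propositional using (_∈_)
open import Data.List.Membership.Propositional.Properties
  using (∈-filter⁺; ∈-filter⁻; ∈-map⁺; ∈-upTo⁺; ∈-cartesianProductWith⁺)
open import Data.List.Properties using (filter-accept; filter-reject; ∷-injective)
open import Data.List.Relation.Unary.All as All using (All; []; _∷_)
open import Data.List.Relation.Unary.Any using (here)
open import Data.List.Relation.Unary.Unique.Propositional using (Unique; []; _∷_)
import Data.List.Relation.Unary.Unique.Propositional.Properties as Unique
open import Data.Nat.Base using (ℕ; zero; suc; _+_; _≤_; _<_; _>_; s≤s)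
open import Data.Nat.Properties using (_≟_; _≤?_; _<?_; suc-injective; +-suc)
open import Data.Product.Base using (∃; _×_; _,_; proj₁; proj₂)
open import Data.Vec.Base as Vec using (Vec; []; _∷_)
open import Data.Vec.Properties using (tabulate∘lookup; tabulate-cong)
open import Function.Base using (_∘_)
open import Function.Bundles using (_⇔_; mk⇔; Equivalence)
open import Level using (0ℓ)
open import Relation.Binary.PropositionalEquality using (_≡_; _≢_; refl; sym; trans; cong; cong₂; subst)
open import Relation.Nullary.Decidable using (Dec; map′; _×-dec_; _→-dec_; ¬?)
open import Relation.Nullary.Negation using (¬_)
open import Relation.Unary using (Pred; Decidable)

Word : Set
Word = List ℕ

-- 1^{a₁} ⋯ k^{aₖ}; the multiplicity of the letter i ∈ {1,…,k} is stored at
-- position i - 1 of the vector.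
record Multiset : Set where
  field
    k   : ℕ
    k≥1 : 1 ≤ k
    a   : Vec ℕ k
    a≥1 : ∀ i → 1 ≤ Vec.lookup a i

  size : ℕ
  size = Vec.sum a

open Multiset public using (size)

occurrences : ℕ → Word → ℕ
occurrences x w = length (filter (x ≟_) w)

IsMultipermutation : Multiset → Word → Set
IsMultipermutation S w =
    (∀ (i : Fin k) → occurrences (suc (toℕ i)) w ≡ Vec.lookup a i)
  × All (λ x → 1 ≤ x × x ≤ k) w
  where open Multiset S

isMultipermutation? : ∀ S → Decidable (IsMultipermutation S)
isMultipermutation? S w =
  Fin.all? (λ i → occurrences (suc (toℕ i)) w ≟ Vec.lookup a i)
  ×-dec All.all? (λ x → (1 ≤? x) ×-dec (x ≤? k)) w
  where open Multiset S

-- All words of length n over {1,…,k}, each listed once.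
words : ℕ → ℕ → List Word
words k zero    = [] ∷ []
words k (suc n) = cartesianProductWith _∷_ (map suc (upTo k)) (words k n)

-- Each multipermutation of S, listed exactly once: see
-- multipermutations-correct and multipermutations-unique below.
multipermutations : Multiset → List Word
multipermutations S = filter (isMultipermutation? S) (words (Multiset.k S) (size S))

-- The position vector is 0-indexed.
IsOccurrence : (ρ π : Word) → Vec (Fin (length π)) (length ρ) → Set
IsOccurrence ρ π i =
    (∀ a b → a Fin.< b → Vec.lookup i a Fin.< Vec.lookup i b)
  × (∀ a b → (lookup π (Vec.lookup i a) < lookup π (Vec.lookup i b) ⇔ lookup ρ a < lookup ρ b)
           × (lookup π (Vec.lookup i a) > lookup π (Vec.lookup i b) ⇔ lookup ρ a > lookup ρ b))

_Contains_ : (π ρ : Word) → Set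
π Contains ρ = ∃ (IsOccurrence ρ π)

_Avoids_ : (π ρ : Word) → Set
π Avoids ρ = ¬ (π Contains ρ)

-- Sets of patterns are finite and given by listing their elements.
PatternSet : Set
PatternSet = List Word

AvoidsAll : PatternSet → Word → Set
AvoidsAll P π = All (π Avoids_) P

_⇔-dec_ : ∀ {A B : Set} → Dec A → Dec B → Dec (A ⇔ B)
A? ⇔-dec B? =
  map′ (λ (f , g) → mk⇔ f g) (λ e → Equivalence.to e , Equivalence.from e)
       ((A? →-dec B?) ×-dec (B? →-dec A?))

anyVec? : ∀ {n} ℓ {P : Pred (Vec (Fin n) ℓ) 0ℓ} → Decidable P → Dec (∃ P)
anyVec? zero    P? = map′ ([] ,_) (λ { ([] , p) → p }) (P? [])
anyVec? (suc ℓ) P? =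
  map′ (λ (x , xs , p) → x ∷ xs , p) (λ { (x ∷ xs , p) → x , xs , p })
       (Fin.any? λ x → anyVec? ℓ λ xs → P? (x ∷ xs))

isOccurrence? : ∀ ρ π → Decidable (IsOccurrence ρ π)
isOccurrence? ρ π i =
  (Fin.all? λ a → Fin.all? λ b → (a Fin.<? b) →-dec (Vec.lookup i a Fin.<? Vec.lookup i b))
  ×-dec
  (Fin.all? λ a → Fin.all? λ b →
    ((lookup π (Vec.lookup i a) <? lookup π (Vec.lookup i b)) ⇔-dec (lookup ρ a <? lookup ρ b))
    ×-dec
    ((lookup π (Vec.lookup i b) <? lookup π (Vec.lookup i a)) ⇔-dec (lookup ρ b <? lookup ρ a)))

_contains?_ : ∀ π ρ → Dec (π Contains ρ)
π contains? ρ = anyVec? (length ρ) (isOccurrence? ρ π)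

avoidsAll? : ∀ P → Decidable (AvoidsAll P)
avoidsAll? P π = All.all? (λ ρ → ¬? (π contains? ρ)) P

av : Multiset → PatternSet → ℕ
av S P = length (filter (avoidsAll? P) (multipermutations S))

infix 4 _∼_

_∼_ : PatternSet → PatternSet → Set
P ∼ Q = ∀ (S : Multiset) → av S P ≡ av S Q

sum-bump : ∀ {k} (f g : Fin k → ℕ) j → f j ≡ suc (g j) → (∀ i → i ≢ j → f i ≡ g i) →
           Vec.sum (Vec.tabulate f) ≡ suc (Vec.sum (Vec.tabulate g))
sum-bump f g zero    fj f≡g =
  cong₂ _+_ fj (cong Vec.sum (tabulate-cong λ i → f≡g (suc i) λ ()))
sum-bump f g (suc j) fj f≡g =
  trans (cong₂ _+_ (f≡g zero λ ())
                   (sum-bump (f ∘ suc) (g ∘ suc) j fj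
                      (λ i i≢j → f≡g (suc i) (i≢j ∘ Fin.suc-injective))))
        (+-suc _ _)

sum-zero : ∀ k → Vec.sum (Vec.tabulate {n = k} λ _ → 0) ≡ 0
sum-zero zero    = refl
sum-zero (suc k) = sum-zero k

occurrences-≡ : ∀ x y w → x ≡ y → occurrences x (y ∷ w) ≡ suc (occurrences x w)
occurrences-≡ x y w x≡y = cong length (filter-accept (x ≟_) {x = y} {xs = w} x≡y)

occurrences-≢ : ∀ x y w → x ≢ y → occurrences x (y ∷ w) ≡ occurrences x w
occurrences-≢ x y w x≢y = cong length (filter-reject (x ≟_) {x = y} {xs = w} x≢y)

sum-occurrences : ∀ k w → All (λ x → 1 ≤ x × x ≤ k) w →
  Vec.sum (Vec.tabulate {n = k} λ i → occurrences (suc (toℕ i)) w) ≡ length w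
sum-occurrences k []          []                = sum-zero k
sum-occurrences k (suc x ∷ w) ((_ , x<k) ∷ ok) =
  trans (sum-bump _ (λ i → occurrences (suc (toℕ i)) w) j
           (occurrences-≡ (suc (toℕ j)) (suc x) w (cong suc j≡x))
           (λ i i≢j → occurrences-≢ (suc (toℕ i)) (suc x) w λ eq →
             i≢j (Fin.toℕ-injective (trans (suc-injective eq) (sym j≡x)))))
        (cong suc (sum-occurrences k w ok))
  where
  j   = fromℕ< x<k
  j≡x = Fin.toℕ-fromℕ< x<k

length≡size : ∀ S w → IsMultipermutation S w → length w ≡ size S
length≡size S w (occ , ok) =
  trans (sym (sum-occurrences (Multiset.k S) w ok))
        (cong Vec.sum (trans (tabulate-cong occ) (tabulate∘lookup (Multiset.a S))))

words-complete : ∀ k w → All (λ x → 1 ≤ x × x ≤ k) w → w ∈ words k (length w)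
words-complete k []          []               = here refl
words-complete k (suc x ∷ w) ((_ , x<k) ∷ ok) =
  ∈-cartesianProductWith⁺ _∷_ (∈-map⁺ suc (∈-upTo⁺ x<k)) (words-complete k w ok)

words-unique : ∀ k n → Unique (words k n)
words-unique k zero    = [] ∷ []
words-unique k (suc n) =
  Unique.cartesianProductWith⁺ _∷_ ∷-injective
    (Unique.map⁺ suc-injective (Unique.upTo⁺ k)) (words-unique k n)

multipermutations-correct : ∀ S w → w ∈ multipermutations S ⇔ IsMultipermutation S w
multipermutations-correct S w = mk⇔
  (λ w∈ → proj₂ (∈-filter⁻ (isMultipermutation? S) {xs = words (Multiset.k S) (size S)} w∈))
  (λ p → ∈-filter⁺ (isMultipermutation? S)
           (subst (λ n → w ∈ words (Multiset.k S) n) (length≡size S w p)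
                  (words-complete (Multiset.k S) w (proj₂ p)))
           p)

multipermutations-unique : ∀ S → Unique (multipermutations S)
multipermutations-unique S =
  Unique.filter⁺ (isMultipermutation? S) (words-unique (Multiset.k S) (size S))

{-# OPTIONS --safe #-}

-- Build words by inserting the copies of the smallest letter m last.  Let w = vu
-- be the word of the larger letters, of length n, and let m have multiplicity b + 1.
--
-- {121, 1122}: the copies of m are consecutive, so the result is v m^(b+1) u, and
-- if b ≥ 1 the letters of u must be distinct.
-- {112, 2121}: all copies of m but the first form a suffix, so the result is
-- v m u m^b, and if b ≥ 1 the words v and u must have no common letter.
--
-- In both cases let c be the number of splits (v , u) of w that are good in the
-- sense required for b ≥ 1.  For b = 0 every split is allowed, and the new value of
-- c is c + 1 for the c good splits and c for the other n + 1 - c splits.  For b ≥ 1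
-- only the c good splits are allowed, and they give the new values 2, 3, …, c + 1.
-- Hence both classes have the same generating tree, labelled by (n , c).
module Submission where

open import Defs
open import Algebra.Properties.CommutativeSemigroup using (x∙yz≈y∙xz)
open import Data.Bool.Base using (Bool; true; false; if_then_else_)
open import Data.Fin.Base as Fin using (Fin; zero; suc; toℕ)
open import Data.List.Base
  using (List; []; _∷_; map; length; lookup; _++_; replicate; concatMap; filter; applyUpTo; applyDownFrom; reverse)
open import Data.List.Membership.DecPropositional using (_∈?_)
open import Data.List.Membership.Propositional using (_∈_; _∉_; find; lose)
open import Data.List.Membership.Propositional.Properties
  using (∈-lookup; ∈-map⁺; ∈-map⁻; ∈-concatMap⁺; ∈-concatMap⁻; ∈-filter⁺; ∈-filter⁻; ∈-++⁻; ∈-++⁺ˡ; ∈-++⁺ʳ)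
open import Data.List.Membership.Propositional.Properties.WithK using (unique∧set⇒bag)
open import Data.List.Properties
open import Data.List.Relation.Binary.BagAndSetEquality using (∼bag⇒↭)
open import Data.List.Relation.Binary.Disjoint.DecPropositional using (disjoint?)
open import Data.List.Relation.Binary.Disjoint.Propositional using (Disjoint)
open import Data.List.Relation.Binary.Permutation.Propositional as ↭
  using (_↭_; prep; swap; ↭-refl; ↭-sym; ↭-trans; ↭-prep; ↭-reflexive; ↭⇒↭ₛ; module PermutationReasoning)
open import Data.List.Relation.Binary.Permutation.Propositional.Properties
  using (shift; shifts; ++⁺; ++⁺ˡ; ++-comm; ↭-length; ↭-reverse; filter-↭; All-resp-↭)
open import Data.List.Relation.Binary.Permutation.Setoid.Properties using (Unique-resp-↭)
open import Data.List.Relation.Binary.Sublist.Propositional as Sublist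
  using (_⊆_; []; _∷_; _∷ʳ_; ⊆-trans; from∈; to∈; minimum)
open import Data.List.Relation.Binary.Sublist.Propositional.Properties
  using (filter-⊆; ∷⁻; ∷ˡ⁻) renaming (++⁺ to ⊆-++⁺; filter⁺ to ⊆-filter⁺)
open import Data.List.Relation.Unary.All as All using (All; []; _∷_)
import Data.List.Relation.Unary.All.Properties as All
open import Data.List.Relation.Unary.Any as Any using (here; there)
open import Data.List.Relation.Unary.Any.Properties using (lookup-index)
open import Data.List.Relation.Unary.Unique.DecPropositional using (unique?)
open import Data.List.Relation.Unary.Unique.Propositional using (Unique; []; _∷_)
import Data.List.Relation.Unary.Unique.Propositional.Properties as Unique
open import Data.Nat.Base using (ℕ; zero; suc; pred; _+_; _∸_; _≤_; _<_; z≤n; s≤s; z<s; s<s)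
open import Data.Nat.Properties
open import Data.Product.Base using (∃; _×_; _,_; proj₁; proj₂; map₁; map₂)
open import Data.Sum.Base using (_⊎_; inj₁; inj₂)
open import Data.Vec.Base as Vec using (Vec; []; _∷_)
open import Data.Vec.Properties using (lookup∘tabulate)
open import Function.Base using (_∘_)
open import Function.Bundles using (_⇔_; mk⇔; Equivalence)
open import Function.Construct.Composition using (_⇔-∘_)
open import Relation.Binary.Definitions using (tri<; tri≈; tri>)
open import Relation.Binary.PropositionalEquality hiding ([_])
open import Relation.Nullary.Decidable using (Dec; does; yes; no; dec-true; dec-false; does-⇔)
open import Relation.Nullary.Negation using (¬_; contradiction)

-- Occurrences of patterns over {1, 2}

StrictlyIncreasing : ∀ {m n} → (Fin m → Fin n) → Set
StrictlyIncreasing f = ∀ i j → i Fin.< j → f i Fin.< f j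

-- The recursion follows `π`: its head is matched if the first position is `zero` and dropped
-- otherwise. In both cases monotonicity makes the positions still to be treated successors, so they
-- can be shifted down to the tail.
increasing⇒⊆ : ∀ (s : ℕ → ℕ) ρ π (f : Fin (length ρ) → Fin (length π)) → StrictlyIncreasing f →
               (∀ i → lookup π (f i) ≡ s (lookup ρ i)) → map s ρ ⊆ π
increasing⇒⊆ s []      π       f f↑ f≗ = minimum π
increasing⇒⊆ s (p ∷ ρ) []      f f↑ f≗ with () ← f zero
increasing⇒⊆ s (p ∷ ρ) (x ∷ π) f f↑ f≗ with f zero in eq
... | zero  = sym (trans (cong (lookup (x ∷ π)) (sym eq)) (f≗ zero)) ∷
  increasing⇒⊆ s ρ π g g↑ λ i → trans (cong (lookup (x ∷ π)) (sym (suc-g i))) (f≗ (suc i))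
  where
  positive : ∀ i → ∃ λ j → f (suc i) ≡ suc j
  positive i with f (suc i) | f↑ zero (suc i) z<s
  ... | suc j | _   = j , refl
  ... | zero  | f₀< rewrite eq with () ← f₀<
  g : Fin _ → Fin _
  g = proj₁ ∘ positive
  suc-g : ∀ i → f (suc i) ≡ suc (g i)
  suc-g = proj₂ ∘ positive
  g↑ : StrictlyIncreasing g
  g↑ i j i<j with s<s lt ← subst₂ Fin._<_ (suc-g i) (suc-g j) (f↑ (suc i) (suc j) (s<s i<j)) = lt
... | suc k = x ∷ʳ
  increasing⇒⊆ s (p ∷ ρ) π g g↑ λ i → trans (cong (lookup (x ∷ π)) (sym (suc-g i))) (f≗ i)
  where
  positive : ∀ i → ∃ λ j → f i ≡ suc j
  positive zero = k , eq
  positive (suc i) with f (suc i) | f↑ zero (suc i) z<s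
  ... | suc j | _   = j , refl
  ... | zero  | f₀< with () ← f₀<
  g : Fin _ → Fin _
  g = proj₁ ∘ positive
  suc-g : ∀ i → f i ≡ suc (g i)
  suc-g = proj₂ ∘ positive
  g↑ : StrictlyIncreasing g
  g↑ i j i<j with s<s lt ← subst₂ Fin._<_ (suc-g i) (suc-g j) (f↑ i j i<j) = lt

⊆⇒increasing : ∀ (s : ℕ → ℕ) ρ π → map s ρ ⊆ π →
               ∃ λ (f : Fin (length ρ) → Fin (length π)) →
                 StrictlyIncreasing f × (∀ i → lookup π (f i) ≡ s (lookup ρ i))
⊆⇒increasing s []      π       _        = (λ ()) , (λ ()) , λ ()
⊆⇒increasing s (p ∷ ρ) (x ∷ π) (.x ∷ʳ τ) with f , f↑ , f≗ ← ⊆⇒increasing s (p ∷ ρ) π τ =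
  suc ∘ f , (λ i j i<j → s<s (f↑ i j i<j)) , f≗
⊆⇒increasing s (p ∷ ρ) (x ∷ π) (eq ∷ τ) with f , f↑ , f≗ ← ⊆⇒increasing s ρ π τ = g , g↑ , g≗
  where
  g : Fin _ → Fin _
  g zero    = zero
  g (suc i) = suc (f i)
  g↑ : StrictlyIncreasing g
  g↑ zero    (suc j) _         = z<s
  g↑ (suc i) (suc j) (s<s i<j) = s<s (f↑ i j i<j)
  g≗ : ∀ i → lookup (x ∷ π) (g i) ≡ s (lookup (p ∷ ρ) i)
  g≗ zero    = sym eq
  g≗ (suc i) = f≗ i

-- Every letter other than 1 gets the default `y`. As only the values `x` and `y` arise, bounds such
-- as `above-m` hold for all pattern letters.
substitute : ℕ → ℕ → ℕ → ℕ
substitute x y 1 = x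
substitute x y _ = y

-- By trichotomy an order isomorphism sends equal letters to equal values, so an occurrence spells a
-- word fixed by the values `x < y` of the letters 1 and 2. These are read off at one position of
-- each letter.
contains-two-letter : ∀ {ρ π} → All (λ p → p ≡ 1 ⊎ p ≡ 2) ρ → 1 ∈ ρ → 2 ∈ ρ →
  π Contains ρ ⇔ (∃ λ x → ∃ λ y → x < y × map (substitute x y) ρ ⊆ π)
contains-two-letter {ρ} {π} letters 1∈ρ 2∈ρ = mk⇔ to from
  where
  to : π Contains ρ → ∃ λ x → ∃ λ y → x < y × map (substitute x y) ρ ⊆ π
  to (v , v↑ , iso) = val (Any.index 1∈ρ) , val (Any.index 2∈ρ) ,
    Equivalence.from (proj₁ (iso (Any.index 1∈ρ) (Any.index 2∈ρ)))
      (subst₂ _<_ (lookup-index 1∈ρ) (lookup-index 2∈ρ) (s<s z<s)) ,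
    increasing⇒⊆ _ ρ π (Vec.lookup v) v↑ val≗
    where
    val : Fin (length ρ) → ℕ
    val i = lookup π (Vec.lookup v i)
    val-cong : ∀ i j → lookup ρ i ≡ lookup ρ j → val i ≡ val j
    val-cong i j eq with <-cmp (val i) (val j)
    ... | tri< lt _ _ = contradiction (Equivalence.to (proj₁ (iso i j)) lt) (<-irrefl eq)
    ... | tri≈ _ eq′ _ = eq′
    ... | tri> _ _ gt = contradiction (Equivalence.to (proj₂ (iso i j)) gt) (<-irrefl (sym eq))
    val≗ : ∀ i → val i ≡ substitute (val (Any.index 1∈ρ)) (val (Any.index 2∈ρ)) (lookup ρ i)
    val≗ i with All.lookup letters (∈-lookup {xs = ρ} i)
    ... | inj₁ eq rewrite eq = val-cong i (Any.index 1∈ρ) (trans eq (lookup-index 1∈ρ))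
    ... | inj₂ eq rewrite eq = val-cong i (Any.index 2∈ρ) (trans eq (lookup-index 2∈ρ))

  from : (∃ λ x → ∃ λ y → x < y × map (substitute x y) ρ ⊆ π) → π Contains ρ
  from (x , y , x<y , τ) with f , f↑ , f≗ ← ⊆⇒increasing (substitute x y) ρ π τ =
    Vec.tabulate f ,
    (λ i j i<j → subst₂ Fin._<_ (sym (lookup∘tabulate f i)) (sym (lookup∘tabulate f j)) (f↑ i j i<j)) ,
    λ i j → order i j , order j i
    where
    monotone : ∀ {p q} → p ≡ 1 ⊎ p ≡ 2 → q ≡ 1 ⊎ q ≡ 2 → substitute x y p < substitute x y q ⇔ p < q
    monotone (inj₁ refl) (inj₁ refl) = mk⇔ (λ lt → contradiction lt (<-irrefl refl)) λ { (s<s ()) }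
    monotone (inj₁ refl) (inj₂ refl) = mk⇔ (λ _ → s<s z<s) (λ _ → x<y)
    monotone (inj₂ refl) (inj₁ refl) = mk⇔ (λ lt → contradiction lt (<-asym x<y)) λ { (s<s ()) }
    monotone (inj₂ refl) (inj₂ refl) = mk⇔ (λ lt → contradiction lt (<-irrefl refl)) λ { (s<s (s<s ())) }

    order : ∀ i j → lookup π (Vec.lookup (Vec.tabulate f) i) < lookup π (Vec.lookup (Vec.tabulate f) j)
                    ⇔ lookup ρ i < lookup ρ j
    order i j rewrite lookup∘tabulate f i | lookup∘tabulate f j | f≗ i | f≗ j =
      monotone (All.lookup letters (∈-lookup {xs = ρ} i)) (All.lookup letters (∈-lookup {xs = ρ} j))

Avoids₂ : Word → Word → Set
Avoids₂ ρ π = ∀ x y → x < y → ¬ map (substitute x y) ρ ⊆ π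

avoids⇔avoids₂ : ∀ {ρ π} → All (λ p → p ≡ 1 ⊎ p ≡ 2) ρ → 1 ∈ ρ → 2 ∈ ρ → π Avoids ρ ⇔ Avoids₂ ρ π
avoids⇔avoids₂ letters 1∈ρ 2∈ρ = mk⇔
  (λ avoids x y x<y τ → avoids (from (x , y , x<y , τ)))
  (λ avoids₂ c → let x , y , x<y , τ = to c in avoids₂ x y x<y τ)
  where open Equivalence (contains-two-letter letters 1∈ρ 2∈ρ)

-- Splits of a word

SplitTest : Set
SplitTest = Word → Word → Bool

bit : Bool → ℕ
bit b = if b then 1 else 0

-- The recursion moves the head of the word into the test, so statements about splits are proved for
-- arbitrary tests by structural induction.
splits : SplitTest → Word → List (Word × Word)
splits good []      = if good [] [] then ([] , []) ∷ [] else []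
splits good (x ∷ w) = (if good [] (x ∷ w) then ([] , x ∷ w) ∷_ else λ ss → ss)
                      (map (map₁ (x ∷_)) (splits (good ∘ (x ∷_)) w))

-- This is the label `c` of the generating tree.
#splits : SplitTest → Word → ℕ
#splits good []      = bit (good [] [])
#splits good (x ∷ w) = bit (good [] (x ∷ w)) + #splits (good ∘ (x ∷_)) w

#splits-cong : ∀ {f g : SplitTest} w → (∀ v u → v ++ u ≡ w → f v u ≡ g v u) → #splits f w ≡ #splits g w
#splits-cong []      f≗g = cong bit (f≗g [] [] refl)
#splits-cong (x ∷ w) f≗g = cong₂ _+_ (cong bit (f≗g [] (x ∷ w) refl))
  (#splits-cong w λ v u eq → f≗g (x ∷ v) u (cong (x ∷_) eq))

#splits≤ : ∀ good w → #splits good w ≤ suc (length w)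
#splits≤ good [] with good [] []
... | true  = s≤s z≤n
... | false = z≤n
#splits≤ good (x ∷ w) with good [] (x ∷ w)
... | true  = s≤s (#splits≤ _ w)
... | false = m≤n⇒m≤1+n (#splits≤ _ w)

∈-splits⁺ : ∀ good v u → good v u ≡ true → (v , u) ∈ splits good (v ++ u)
∈-splits⁺ good [] []      eq rewrite eq = here refl
∈-splits⁺ good [] (x ∷ u) eq rewrite eq = here refl
∈-splits⁺ good (x ∷ v) u eq with good [] (x ∷ v ++ u)
... | true  = there (∈-map⁺ _ (∈-splits⁺ (good ∘ (x ∷_)) v u eq))
... | false = ∈-map⁺ _ (∈-splits⁺ (good ∘ (x ∷_)) v u eq)

∈-splits⁻ : ∀ good w {v u} → (v , u) ∈ splits good w → v ++ u ≡ w × good v u ≡ true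
∈-splits⁻ good [] v,u∈ with good [] [] in eq
∈-splits⁻ good [] (here refl) | true = refl , eq
∈-splits⁻ good (x ∷ w) v,u∈ = go (good [] (x ∷ w)) refl v,u∈
  where
  tail : ∀ {v u} → (v , u) ∈ map (map₁ (x ∷_)) (splits (good ∘ (x ∷_)) w) → v ++ u ≡ x ∷ w × good v u ≡ true
  tail ∈map with (v′ , u′) , ∈s , refl ← ∈-map⁻ (map₁ (x ∷_)) ∈map =
    let eq , ok = ∈-splits⁻ (good ∘ (x ∷_)) w ∈s in cong (x ∷_) eq , ok
  go : ∀ {v u} b → good [] (x ∷ w) ≡ b →
       (v , u) ∈ (if b then ([] , x ∷ w) ∷_ else λ ss → ss) (map (map₁ (x ∷_)) (splits (good ∘ (x ∷_)) w)) →
       v ++ u ≡ x ∷ w × good v u ≡ true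
  go true  eq (here refl) = refl , eq
  go true  eq (there ∈t)  = tail ∈t
  go false eq ∈t          = tail ∈t

splits-unique : ∀ good w → Unique (splits good w)
splits-unique good [] with good [] []
... | true  = [] ∷ []
... | false = []
splits-unique good (x ∷ w) = go (good [] (x ∷ w))
  where
  tail : Unique (map (map₁ (x ∷_)) (splits (good ∘ (x ∷_)) w))
  tail = Unique.map⁺ (λ { {_ , _} {_ , _} refl → refl }) (splits-unique (good ∘ (x ∷_)) w)
  go : ∀ b → Unique ((if b then ([] , x ∷ w) ∷_ else λ ss → ss) (map (map₁ (x ∷_)) (splits (good ∘ (x ∷_)) w)))
  go true  = All.tabulate (λ ∈t eq → []∉ (subst (_∈ _) (sym eq) ∈t)) ∷ tail
    where
    []∉ : ¬ ([] , x ∷ w) ∈ map (map₁ (x ∷_)) (splits (good ∘ (x ∷_)) w)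
    []∉ ∈map with _ , _ , () ← ∈-map⁻ (map₁ (x ∷_)) ∈map
  go false = tail

-- With `f b = bit b + c` this gives the labels that arise when a single copy of the smallest letter
-- is inserted.
split-tally : ∀ {A : Set} (f : Bool → A) good w →
  map (λ (v , u) → f (good v u)) (splits (λ _ _ → true) w) ↭
  replicate (#splits good w) (f true) ++ replicate (suc (length w) ∸ #splits good w) (f false)
split-tally f good [] with good [] []
... | true  = ↭-refl
... | false = ↭-refl
split-tally f good (x ∷ w) with good [] (x ∷ w) | split-tally f (good ∘ (x ∷_)) w
... | true  | ih = ↭-prep _ (↭-trans (↭-reflexive (sym (map-∘ (splits _ w)))) ih)
-- By `#splits≤` the truncated subtraction is exact, so the additional bad split is one more
-- `f false`; `shift` moves it behind the good ones.
... | false | ih rewrite +-∸-assoc 1 (#splits≤ (good ∘ (x ∷_)) w) =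
  ↭-trans (↭-prep _ (↭-trans (↭-reflexive (sym (map-∘ (splits _ w)))) ih))
          (↭-sym (shift _ (replicate (#splits (good ∘ (x ∷_)) w) (f true)) _))

-- The cut between `v` and `u` becomes two cuts, one on each side of `m`, both as good as the old
-- one. All other cuts keep their value, so only `(v , u)` is counted once more.
#splits-insert : ∀ {m} (good : SplitTest) →
  (∀ {v v′ u} → All (m <_) v → All (m <_) v′ → All (m <_) u → good (v ++ m ∷ v′) u ≡ good (v ++ v′) u) →
  (∀ {v u u′} → All (m <_) v → All (m <_) u → All (m <_) u′ → good v (u ++ m ∷ u′) ≡ good v (u ++ u′)) →
  ∀ {v u} → All (m <_) v → All (m <_) u →
  #splits good (v ++ m ∷ u) ≡ bit (good v u) + #splits good (v ++ u)
#splits-insert {m} good insˡ insʳ {[]} {u} [] m<u =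
  cong₂ _+_ (cong bit (insʳ [] [] m<u))
    (#splits-cong u λ { v′ u′ refl → insˡ [] (All.++⁻ˡ v′ m<u) (All.++⁻ʳ v′ m<u) })
#splits-insert {m} good insˡ insʳ {x ∷ v} {u} (m<x ∷ m<v) m<u = begin
  bit (good [] (x ∷ v ++ m ∷ u)) + #splits (good ∘ (x ∷_)) (v ++ m ∷ u)
    ≡⟨ cong₂ _+_ (cong bit (insʳ [] (m<x ∷ m<v) m<u))
         (#splits-insert (good ∘ (x ∷_)) (λ m<v → insˡ (m<x ∷ m<v)) (λ m<v → insʳ (m<x ∷ m<v)) m<v m<u) ⟩
  bit (good [] (x ∷ v ++ u)) + (bit (good (x ∷ v) u) + #splits (good ∘ (x ∷_)) (v ++ u))
    ≡⟨ x∙yz≈y∙xz +-commutativeSemigroup (bit (good [] (x ∷ v ++ u))) (bit (good (x ∷ v) u)) _ ⟩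
  bit (good (x ∷ v) u) + (bit (good [] (x ∷ v ++ u)) + #splits (good ∘ (x ∷_)) (v ++ u)) ∎
  where
  open ≡-Reasoning

-- The generating tree of a class closed under insertion of a smallest letter

module _ {A B : Set} where

  concatMap-↭ : ∀ (f : A → List B) {xs ys} → xs ↭ ys → concatMap f xs ↭ concatMap f ys
  concatMap-↭ f ↭.refl         = ↭-refl
  concatMap-↭ f (prep x p)   = ++⁺ˡ (f x) (concatMap-↭ f p)
  concatMap-↭ f (swap x y p) = ↭-trans (shifts (f x) (f y)) (++⁺ˡ (f y) (++⁺ˡ (f x) (concatMap-↭ f p)))
  concatMap-↭ f (↭.trans p q)  = ↭-trans (concatMap-↭ f p) (concatMap-↭ f q)

  concatMap-cong-↭ : ∀ {f g : A → List B} {xs} → All (λ x → f x ↭ g x) xs → concatMap f xs ↭ concatMap g xs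
  concatMap-cong-↭ []       = ↭-refl
  concatMap-cong-↭ (p ∷ ps) = ++⁺ p (concatMap-cong-↭ ps)

  -- Injectivity is asked of members only, since `glue` is injective among the splits of one word
  -- over larger letters but not among all pairs.
  unique-map : ∀ (f : A → B) {xs} → (∀ {x y} → x ∈ xs → y ∈ xs → f x ≡ f y → x ≡ y) →
               Unique xs → Unique (map f xs)
  unique-map f inj []       = []
  unique-map f inj (x∉ ∷ !) =
    All.map⁺ (All.tabulate λ y∈ eq → All.lookup x∉ y∈ (inj (here refl) (there y∈) eq)) ∷
    unique-map f (λ x∈ y∈ → inj (there x∈) (there y∈)) !

  unique-concatMap : ∀ (f : A → List B) {xs} → All (Unique ∘ f) xs →
    (∀ {x y z} → x ∈ xs → y ∈ xs → z ∈ f x → z ∈ f y → x ≡ y) → Unique xs → Unique (concatMap f xs)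
  unique-concatMap f []        sep []       = []
  unique-concatMap f {x ∷ xs} (f! ∷ fs!) sep (x∉ ∷ !) =
    Unique.++⁺ f! (unique-concatMap f fs! (λ x∈ y∈ → sep (there x∈) (there y∈)) !)
      λ (z∈fx , z∈rest) → let y , y∈ , z∈fy = find (∈-concatMap⁻ f z∈rest) in
        All.lookup x∉ y∈ (sep (here refl) (there y∈) z∈fx z∈fy)

-- Multiplicities and the letters above `m`

occurrences-++ : ∀ x v u → occurrences x (v ++ u) ≡ occurrences x v + occurrences x u
occurrences-++ x v u = trans (cong length (filter-++ (x ≟_) v u)) (length-++ (filter (x ≟_) v))

occurrences-∷ : ∀ x y {v u} → occurrences x v ≡ occurrences x u → occurrences x (y ∷ v) ≡ occurrences x (y ∷ u)
occurrences-∷ x y {v} {u} eq = begin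
  occurrences x (y ∷ v)                                   ≡⟨ occurrences-++ x (y ∷ []) v ⟩
  occurrences x (y ∷ []) + occurrences x v                ≡⟨ cong (occurrences x (y ∷ []) +_) eq ⟩
  occurrences x (y ∷ []) + occurrences x u                ≡⟨ occurrences-++ x (y ∷ []) u ⟨
  occurrences x (y ∷ u)                                   ∎
  where open ≡-Reasoning

occurrences-↭ : ∀ x {v u} → v ↭ u → occurrences x v ≡ occurrences x u
occurrences-↭ x = ↭-length ∘ filter-↭ (x ≟_)

occurrences-> : ∀ {m w} → All (m <_) w → occurrences m w ≡ 0
occurrences-> m<w = cong length (filter-none (_ ≟_) (All.map <⇒≢ m<w))

occurrences-replicate : ∀ m b → occurrences m (replicate b m) ≡ b
occurrences-replicate m zero    = refl
occurrences-replicate m (suc b) = trans (occurrences-≡ m m _ refl) (cong suc (occurrences-replicate m b))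

above : ℕ → Word → Word
above m = filter (m <?_)

above-All : ∀ m w → All (m <_) (above m w)
above-All m = All.all-filter (m <?_)

occurrences-above : ∀ {m x} → m < x → ∀ w → occurrences x (above m w) ≡ occurrences x w
occurrences-above m<x [] = refl
occurrences-above {m} {x} m<x (y ∷ w) with m <? y
... | no m≮y  = trans (cong (occurrences x) (filter-reject (m <?_) m≮y))
  (trans (occurrences-above m<x w) (sym (occurrences-≢ x y w λ { refl → m≮y m<x })))
... | yes m<y = trans (cong (occurrences x) (filter-accept (m <?_) m<y)) (occurrences-∷ x y (occurrences-above m<x w))

above-insert : ∀ {m v r u} → All (m <_) v → above m r ≡ u → above m (v ++ m ∷ r) ≡ v ++ u
above-insert {m} {v} {r} m<v eq = trans (filter-++ (m <?_) v (m ∷ r))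
  (cong₂ _++_ (filter-all (m <?_) m<v) (trans (filter-reject (m <?_) (<-irrefl refl)) eq))

-- Neither prefix contains `m`, so in both factorisations the displayed `m` is the first one.
first-occurrence-unique : ∀ {m v v′ r r′} → All (m <_) v → All (m <_) v′ → v ++ m ∷ r ≡ v′ ++ m ∷ r′ → v ≡ v′
first-occurrence-unique []          []           eq = refl
first-occurrence-unique []          (m<m ∷ _)  refl = contradiction m<m (<-irrefl refl)
first-occurrence-unique (m<m ∷ _)   []         refl = contradiction m<m (<-irrefl refl)
first-occurrence-unique (_ ∷ m<v) (_ ∷ m<v′) eq with refl , eq′ ← ∷-injective eq =
  cong (_ ∷_) (first-occurrence-unique m<v m<v′ eq′)

first-occurrence : ∀ {m b} w → All (m ≤_) w → occurrences m w ≡ suc b →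
                   ∃ λ v → ∃ λ r → w ≡ v ++ m ∷ r × All (m <_) v × All (m ≤_) r × occurrences m r ≡ b
first-occurrence {m} (x ∷ w) (m≤x ∷ m≤w) occ with m ≟ x
... | yes refl = [] , w , refl , [] , m≤w , suc-injective (trans (sym (occurrences-≡ m m w refl)) occ)
... | no  m≢x with v , r , refl , m<v , m≤r , occ′ ← first-occurrence w m≤w (trans (sym (occurrences-≢ m x w m≢x)) occ) =
  x ∷ v , r , refl , ≤∧≢⇒< m≤x m≢x ∷ m<v , m≤r , occ′

-- A description of a class of words by insertion of the smallest letter:
-- suc b copies of m are inserted into v ++ u, giving v ++ m ∷ fill m b u; if
-- b is positive then the split (v , u) has to be good.
record Scheme : Set₁ where
  field
    Av   : Word → Set
    good : SplitTest
    fill : ℕ → ℕ → Word → Word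

    Av-[] : Av []
    Av-⊆  : ∀ {σ w} → σ ⊆ w → Av w → Av σ

    fill-zero  : ∀ m u → fill m 0 u ≡ u
    fill-↭     : ∀ m b u → fill m b u ↭ replicate b m ++ u
    above-fill : ∀ {m} b {u} → All (m <_) u → above m (fill m b u) ≡ u

    Av-fill⁺ : ∀ {m} b {v u} → All (m <_) v → All (m <_) u → Av (v ++ u) →
               (1 ≤ b → good v u ≡ true) → Av (v ++ m ∷ fill m b u)
    Av-fill⁻ : ∀ {m v r} b → All (m <_) v → All (m ≤_) r → occurrences m r ≡ b → Av (v ++ m ∷ r) →
               ∃ λ u → All (m <_) u × r ≡ fill m b u × (1 ≤ b → good v u ≡ true)

    good-[] : good [] [] ≡ true
    good-insertˡ : ∀ {m v v′ u} → All (m <_) v → All (m <_) v′ → All (m <_) u →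
                   good (v ++ m ∷ v′) u ≡ good (v ++ v′) u
    good-insertʳ : ∀ {m v u u′} → All (m <_) v → All (m <_) u → All (m <_) u′ →
                   good v (u ++ m ∷ u′) ≡ good v (u ++ u′)

    -- At least two copies of `m` are inserted here, and the new labels 2, ..., c + 1 do not depend
    -- on their number. A permutation is allowed because schemes may list the splits in different
    -- orders of label.
    #splits-fill : ∀ {m} b {w} → All (m <_) w →
      map (λ (v , u) → #splits good (v ++ m ∷ fill m (suc b) u)) (splits good w) ↭
      applyUpTo (2 +_) (#splits good w)

-- The labels below a node `(n , c)`, for a multiplicity one larger than the first argument. Here
-- `suc n ∸ c` is the number of bad splits.
children : ℕ → ℕ → ℕ → List ℕ
children zero    n c = replicate c (suc c) ++ replicate (suc n ∸ c) c
children (suc b) n c = applyUpTo (2 +_) c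

-- The labels of all words with the given multiplicities. The root label 1 belongs to the empty
-- word, whose single split is good; `Vec.sum as` is the common length of the parents.
profile : ∀ {k} → Vec ℕ k → List ℕ
profile []       = 1 ∷ []
profile (a ∷ as) = concatMap (children (pred a) (Vec.sum as)) (profile as)

InRange : ℕ → ℕ → Word → Set
InRange m k = All λ x → m ≤ x × x < m + k

-- The alphabet starts at `m`, so that erasing its smallest letter leaves an instance of the same
-- predicate at `suc m`.
HasContent : ∀ {k} → ℕ → Vec ℕ k → Word → Set
HasContent {k} m as w = (∀ i → occurrences (m + toℕ i) w ≡ Vec.lookup as i) × InRange m k w

hasContent-above : ∀ {k} m a (as : Vec ℕ k) w →
  HasContent m (a ∷ as) w ⇔ (All (m ≤_) w × occurrences m w ≡ a × HasContent (suc m) as (above m w))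
hasContent-above {k} m a as w = mk⇔ to from
  where
  occ : ∀ i → occurrences (m + suc i) w ≡ occurrences (suc m + i) (above m w)
  occ i = trans (cong (λ x → occurrences x w) (+-suc m i)) (sym (occurrences-above (s≤s (m≤m+n m i)) w))

  to : HasContent m (a ∷ as) w → All (m ≤_) w × occurrences m w ≡ a × HasContent (suc m) as (above m w)
  to (content , range) = All.map proj₁ range ,
    trans (cong (λ x → occurrences x w) (sym (+-identityʳ m))) (content zero) ,
    (λ i → trans (sym (occ (toℕ i))) (content (suc i))) ,
    All.zip (above-All m w , All.map (λ {x} → subst (x <_) (+-suc m k) ∘ proj₂) (All.filter⁺ (m <?_) range))

  from : All (m ≤_) w × occurrences m w ≡ a × HasContent (suc m) as (above m w) → HasContent m (a ∷ as) w
  from (m≤w , occ-m , content , range) =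
    (λ { zero    → trans (cong (λ x → occurrences x w) (+-identityʳ m)) occ-m
       ; (suc i) → trans (occ (toℕ i)) (content i) }) ,
    All.tabulate λ x∈ → All.lookup m≤w x∈ , bound x∈
    where
    bound : ∀ {x} → x ∈ w → x < m + suc k
    bound {x} x∈ with m <? x
    ... | yes m<x = subst (x <_) (sym (+-suc m k)) (proj₂ (All.lookup range (∈-filter⁺ (m <?_) x∈ m<x)))
    ... | no  m≮x = ≤-<-trans (≮⇒≥ m≮x) (m<m+n m z<s)

-- Generation of the avoiders from a scheme

module Generation (scheme : Scheme) where
  open Scheme scheme

  glue : ℕ → ℕ → Word × Word → Word
  glue m b (v , u) = v ++ m ∷ fill m b u

  admissible : ℕ → SplitTest
  admissible zero    = λ _ _ → true
  admissible (suc _) = good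

  admissible⇒good : ∀ b {v u} → admissible b v u ≡ true → 1 ≤ b → good v u ≡ true
  admissible⇒good (suc b) ok _ = ok

  good⇒admissible : ∀ b {v u} → (1 ≤ b → good v u ≡ true) → admissible b v u ≡ true
  good⇒admissible zero    ok = refl
  good⇒admissible (suc b) ok = ok (s≤s z≤n)

  insertions : ℕ → ℕ → Word → List Word
  insertions m b w = map (glue m b) (splits (admissible b) w)

  avoiders : ∀ {k} → ℕ → Vec ℕ k → List Word
  avoiders m []       = [] ∷ []
  avoiders m (a ∷ as) = concatMap (insertions m (pred a)) (avoiders (suc m) as)

  glue-↭ : ∀ m b v u → glue m b (v , u) ↭ replicate (suc b) m ++ v ++ u
  glue-↭ m b v u = begin
    v ++ m ∷ fill m b u        ↭⟨ shift m v (fill m b u) ⟩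
    m ∷ v ++ fill m b u        ↭⟨ ↭-prep m (++⁺ˡ v (fill-↭ m b u)) ⟩
    m ∷ v ++ replicate b m ++ u ↭⟨ ↭-prep m (shifts v (replicate b m)) ⟩
    m ∷ replicate b m ++ v ++ u ∎
    where open PermutationReasoning

  above-glue : ∀ {m} b {v u} → All (m <_) v → All (m <_) u → above m (glue m b (v , u)) ≡ v ++ u
  above-glue b m<v m<u = above-insert m<v (above-fill b m<u)

  -- Multiplicity, lower bound and length follow from the rearrangement `glue-↭`; the first
  -- component says that erasing `m` recovers the parent.
  insertions-sound : ∀ {m} b {w z} → All (m <_) w → Av w → z ∈ insertions m b w →
    above m z ≡ w × occurrences m z ≡ suc b × All (m ≤_) z × length z ≡ suc b + length w × Av z
  insertions-sound {m} b {w} m<w av z∈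
    with (v , u) , vu∈ , refl ← ∈-map⁻ (glue m b) z∈
    with refl , ok ← ∈-splits⁻ (admissible b) w vu∈ =
    above-glue b m<v m<u ,
    (begin
      occurrences m (glue m b (v , u))                              ≡⟨ occurrences-↭ m (glue-↭ m b v u) ⟩
      occurrences m (replicate (suc b) m ++ v ++ u)                 ≡⟨ occurrences-++ m (replicate (suc b) m) (v ++ u) ⟩
      occurrences m (replicate (suc b) m) + occurrences m (v ++ u)  ≡⟨ cong₂ _+_ (occurrences-replicate m (suc b)) (occurrences-> m<w) ⟩
      suc b + 0                                                     ≡⟨ +-identityʳ (suc b) ⟩
      suc b                                                         ∎) ,
    All-resp-↭ (↭-sym (glue-↭ m b v u)) (All.++⁺ (All.replicate⁺ (suc b) ≤-refl) (All.map <⇒≤ m<w)) ,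
    trans (↭-length (glue-↭ m b v u))
      (trans (length-++ (replicate (suc b) m)) (cong (_+ length (v ++ u)) (length-replicate (suc b)))) ,
    Av-fill⁺ b m<v m<u av (admissible⇒good b ok)
    where
    open ≡-Reasoning
    m<v = All.++⁻ˡ v m<w
    m<u = All.++⁻ʳ v m<w

  -- The part before the first `m` is `v`, and by `Av-fill⁻` avoidance forces the part after it to
  -- be a filling.
  insertions-complete : ∀ {m} b {z} → All (m ≤_) z → occurrences m z ≡ suc b → Av z → z ∈ insertions m b (above m z)
  insertions-complete {m} b m≤z occ av
    with v , r , refl , m<v , m≤r , occ′ ← first-occurrence _ m≤z occ
    with u , m<u , refl , ok ← Av-fill⁻ b m<v m≤r occ′ av
    rewrite above-glue b m<v m<u =
    ∈-map⁺ (glue m b) (∈-splits⁺ (admissible b) v u (good⇒admissible b ok))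

  insertions-unique : ∀ {m} b {w} → All (m <_) w → Unique (insertions m b w)
  insertions-unique {m} b {w} m<w = unique-map (glue m b) inj (splits-unique (admissible b) w)
    where
    inj : ∀ {s t} → s ∈ splits (admissible b) w → t ∈ splits (admissible b) w → glue m b s ≡ glue m b t → s ≡ t
    inj {v , u} {v′ , u′} s∈ t∈ eq
      with refl , _ ← ∈-splits⁻ (admissible b) w s∈
      with v′u′≡vu , _ ← ∈-splits⁻ (admissible b) w t∈
      -- Cutting at the first `m` recovers the prefix; the suffix follows because both pairs split
      -- the same `w`.
      with refl ← first-occurrence-unique (All.++⁻ˡ v m<w) (All.++⁻ˡ v′ (subst (All (m <_)) (sym v′u′≡vu) m<w)) eq
      = cong (v ,_) (sym (++-cancelˡ v _ _ v′u′≡vu))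

  -- Erasing the smallest letter leaves a sublist, hence an avoider by `Av-⊆`. So every avoider
  -- arises by insertion into one over the larger letters.
  avoiders-correct : ∀ {k} m (as : Vec ℕ k) → (∀ i → 1 ≤ Vec.lookup as i) →
                     ∀ {w} → w ∈ avoiders m as ⇔ (HasContent m as w × Av w)
  avoiders-correct m [] _ = mk⇔
    (λ { (here refl) → ((λ ()) , []) , Av-[] })
    (λ { ((_ , []) , _) → here refl
       -- No letter lies in the empty range from `m` to `m + 0`.
       ; ((_ , (m≤x , x<m) ∷ _) , _) → contradiction (subst (_ <_) (+-identityʳ m) x<m) (≤⇒≯ m≤x) })
  avoiders-correct m (zero  ∷ as) a≥1 with () ← a≥1 zero
  avoiders-correct m (suc b ∷ as) a≥1 {w} = mk⇔ to from
    where
    module IH {w} = Equivalence (avoiders-correct (suc m) as (a≥1 ∘ suc) {w})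
    open Equivalence (hasContent-above m (suc b) as w) renaming (to to split; from to join)
    to : w ∈ avoiders m (suc b ∷ as) → HasContent m (suc b ∷ as) w × Av w
    to w∈ with w′ , w′∈ , w∈ins ← find (∈-concatMap⁻ (insertions m b) w∈)
          with content , av ← IH.to w′∈
          with refl , occ , m≤w , _ , av′ ← insertions-sound b (All.map proj₁ (proj₂ content)) av w∈ins
      = join (m≤w , occ , content) , av′
    from : HasContent m (suc b ∷ as) w × Av w → w ∈ avoiders m (suc b ∷ as)
    from (content , av) with m≤w , occ , content′ ← split content =
      ∈-concatMap⁺ (insertions m b)
        (lose (IH.from (content′ , Av-⊆ (filter-⊆ (m <?_) w) av)) (insertions-complete b m≤w occ av))

  avoiders-> : ∀ {k} m (as : Vec ℕ k) → (∀ i → 1 ≤ Vec.lookup as i) →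
               ∀ {w} → w ∈ avoiders (suc m) as → All (m <_) w × Av w
  avoiders-> m as a≥1 w∈ with (_ , range) , av ← Equivalence.to (avoiders-correct (suc m) as a≥1) w∈ =
    All.map proj₁ range , av

  -- Distinct parents have no common child, because `above m` recovers the parent.
  avoiders-unique : ∀ {k} m (as : Vec ℕ k) → (∀ i → 1 ≤ Vec.lookup as i) → Unique (avoiders m as)
  avoiders-unique m []       a≥1 = [] ∷ []
  avoiders-unique m (a ∷ as) a≥1 = unique-concatMap (insertions m (pred a))
    (All.tabulate λ w∈ → insertions-unique (pred a) (proj₁ (letters w∈)))
    (λ x∈ y∈ z∈x z∈y → trans (sym (base x∈ z∈x)) (base y∈ z∈y))
    (avoiders-unique (suc m) as (a≥1 ∘ suc))
    where
    letters : ∀ {w} → w ∈ avoiders (suc m) as → All (m <_) w × Av w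
    letters = avoiders-> m as (a≥1 ∘ suc)
    base : ∀ {w z} → w ∈ avoiders (suc m) as → z ∈ insertions m (pred a) w → above m z ≡ w
    base w∈ z∈ = let m<w , av = letters w∈ in proj₁ (insertions-sound (pred a) m<w av z∈)

  avoiders-length : ∀ {k} m (as : Vec ℕ k) → (∀ i → 1 ≤ Vec.lookup as i) →
                    ∀ {w} → w ∈ avoiders m as → length w ≡ Vec.sum as
  avoiders-length m []           a≥1 (here refl) = refl
  avoiders-length m (zero  ∷ as) a≥1 with () ← a≥1 zero
  avoiders-length m (suc b ∷ as) a≥1 w∈
    with w′ , w′∈ , w∈ins ← find (∈-concatMap⁻ (insertions m b) w∈)
    with m<w′ , av ← avoiders-> m as (a≥1 ∘ suc) w′∈
    with _ , _ , _ , len , _ ← insertions-sound b m<w′ av w∈ins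
    = trans len (cong (suc b +_) (avoiders-length (suc m) as (a≥1 ∘ suc) w′∈))

  -- For one copy, `#splits-insert` adds 1 to the label exactly at the good splits, and
  -- `split-tally` collects the values. For more copies this is the field `#splits-fill`.
  insertions-children : ∀ {m} b {w} → All (m <_) w →
    map (#splits good) (insertions m b w) ↭ children b (length w) (#splits good w)
  insertions-children {m} (suc b) {w} m<w = ↭-trans (↭-reflexive (sym (map-∘ (splits good w)))) (#splits-fill b m<w)
  insertions-children {m} zero    {w} m<w = begin
    map (#splits good) (map (glue m 0) (splits always w))             ≡⟨ map-∘ (splits always w) ⟨
    map (#splits good ∘ glue m 0) (splits always w)                   ≡⟨ map-cong-local (All.tabulate count) ⟩
    map (λ (v , u) → bit (good v u) + #splits good w) (splits always w) ↭⟨ split-tally (λ b → bit b + #splits good w) good w ⟩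
    children 0 (length w) (#splits good w)                            ∎
    where
    open PermutationReasoning
    always : SplitTest
    always _ _ = true
    count : ∀ {s} → s ∈ splits always w →
            #splits good (glue m 0 s) ≡ bit (good (proj₁ s) (proj₂ s)) + #splits good w
    count {v , u} s∈ with refl , _ ← ∈-splits⁻ always w s∈ rewrite fill-zero m u =
      #splits-insert good good-insertˡ good-insertʳ (All.++⁻ˡ v m<w) (All.++⁻ʳ v m<w)

  -- The labels of the children depend on a word only through its length and its own label, so the
  -- multiset of labels obeys the recursion of `profile`.
  avoiders-profile : ∀ {k} m (as : Vec ℕ k) → (∀ i → 1 ≤ Vec.lookup as i) →
                     map (#splits good) (avoiders m as) ↭ profile as
  avoiders-profile m []       a≥1 rewrite good-[] = ↭-refl
  avoiders-profile m (a ∷ as) a≥1 = begin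
    map st (concatMap (insertions m b) ws)                 ≡⟨ map-concatMap st (insertions m b) ws ⟩
    concatMap (map st ∘ insertions m b) ws                 ↭⟨ concatMap-cong-↭ (All.tabulate step) ⟩
    concatMap (children b (Vec.sum as) ∘ st) ws            ≡⟨ concatMap-map (children b (Vec.sum as)) st ws ⟨
    concatMap (children b (Vec.sum as)) (map st ws)        ↭⟨ concatMap-↭ _ (avoiders-profile (suc m) as (a≥1 ∘ suc)) ⟩
    concatMap (children b (Vec.sum as)) (profile as)       ∎
    where
    open PermutationReasoning
    b  = pred a
    ws = avoiders (suc m) as
    st = #splits good
    step : ∀ {w} → w ∈ ws → map st (insertions m b w) ↭ children b (Vec.sum as) (st w)
    step {w} w∈ = subst (λ n → map st (insertions m b w) ↭ children b n (st w))
      (avoiders-length (suc m) as (a≥1 ∘ suc) w∈)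
      (insertions-children b (proj₁ (avoiders-> m as (a≥1 ∘ suc) w∈)))

  isMultipermutation⇔hasContent : ∀ S w → IsMultipermutation S w ⇔ HasContent 1 (Multiset.a S) w
  isMultipermutation⇔hasContent S w =
    mk⇔ (map₂ (All.map (map₂ s≤s))) (map₂ (All.map (map₂ ≤-pred)))

  -- Two duplicate-free lists with the same members have equal length. The right-hand side does not
  -- mention the scheme, so any two pattern sets described by schemes are m-equivalent.
  av≡profile : ∀ P → (∀ w → AvoidsAll P w ⇔ Av w) → ∀ S → av S P ≡ length (profile (Multiset.a S))
  av≡profile P P⇔Av S = begin
    av S P                                      ≡⟨ ↭-length (∼bag⇒↭ (unique∧set⇒bag
                                                     (Unique.filter⁺ (avoidsAll? P) (multipermutations-unique S))
                                                     (avoiders-unique 1 a a≥1) (mk⇔ to from))) ⟩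
    length (avoiders 1 a)                       ≡⟨ length-map (#splits good) (avoiders 1 a) ⟨
    length (map (#splits good) (avoiders 1 a))  ≡⟨ ↭-length (avoiders-profile 1 a a≥1) ⟩
    length (profile a)                          ∎
    where
    open ≡-Reasoning
    open Multiset S
    to : ∀ {w} → w ∈ filter (avoidsAll? P) (multipermutations S) → w ∈ avoiders 1 a
    to {w} w∈ with w∈S , avoids ← ∈-filter⁻ (avoidsAll? P) {xs = multipermutations S} w∈ =
      Equivalence.from (avoiders-correct 1 a a≥1)
        ( Equivalence.to (isMultipermutation⇔hasContent S w) (Equivalence.to (multipermutations-correct S w) w∈S)
        , Equivalence.to (P⇔Av w) avoids)
    from : ∀ {w} → w ∈ avoiders 1 a → w ∈ filter (avoidsAll? P) (multipermutations S)
    from {w} w∈ with content , avoids ← Equivalence.to (avoiders-correct 1 a a≥1) w∈ =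
      ∈-filter⁺ (avoidsAll? P)
        (Equivalence.from (multipermutations-correct S w) (Equivalence.from (isMultipermutation⇔hasContent S w) content))
        (Equivalence.from (P⇔Av w) avoids)

-- The two classes

p112 p2121 p121 p1122 : Word
p112  = 1 ∷ 1 ∷ 2 ∷ []
p2121 = 2 ∷ 1 ∷ 2 ∷ 1 ∷ []
p121  = 1 ∷ 2 ∷ 1 ∷ []
p1122 = 1 ∷ 1 ∷ 2 ∷ 2 ∷ []

-- Embeddings, distinct letters and disjoint words

does-true⇒ : ∀ {A : Set} (A? : Dec A) → does A? ≡ true → A
does-true⇒ (yes a) _ = a

-- The first embedded letter has no match in `v`, so the whole embedding lies to the right of `v`.
skip : ∀ {x : ℕ} {σ} v {r} → x ∉ v → x ∷ σ ⊆ v ++ r → x ∷ σ ⊆ r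
skip []      x∉v τ          = τ
skip (y ∷ v) x∉v (.y ∷ʳ τ)  = skip v (x∉v ∘ there) τ
skip (y ∷ v) x∉v (refl ∷ τ) = contradiction (here refl) x∉v

>⇒∉ : ∀ {m w} → All (m <_) w → m ∉ w
>⇒∉ m<w m∈w = <-irrefl refl (All.lookup m<w m∈w)

∈-replicate⁻ : ∀ {x y : ℕ} b → y ∈ replicate b x → y ≡ x
∈-replicate⁻ {x} b = All.lookup (All.replicate⁺ {P = _≡ x} b refl)

∉-replicate : ∀ {x y} b → x < y → y ∉ replicate b x
∉-replicate b x<y y∈ = <⇒≢ x<y (sym (∈-replicate⁻ b y∈))

above-none : ∀ m b → above m (replicate b m) ≡ []
above-none m b = filter-none (m <?_) (All.replicate⁺ b (<-irrefl refl))

avoids₂-⊆ : ∀ ρ {σ w} → σ ⊆ w → Avoids₂ ρ w → Avoids₂ ρ σ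
avoids₂-⊆ ρ τ avoids x y x<y occ = avoids x y x<y (⊆-trans occ τ)

-- An occurrence whose smaller value is not the minimum `m` uses only letters above `m`, so it
-- survives the filter. After an insertion only patterns with smaller value `m` remain to be
-- excluded.
avoids₂-above⁻ : ∀ ρ {m w} → 1 ∈ ρ → All (m ≤_) w → Avoids₂ ρ (above m w) →
                 (∀ y → m < y → ¬ map (substitute m y) ρ ⊆ w) → Avoids₂ ρ w
avoids₂-above⁻ ρ {m} {w} 1∈ρ m≤w avoids avoids-m x y x<y τ with m ≟ x
... | yes refl = avoids-m y x<y τ
... | no  m≢x  = avoids x y x<y
  (subst (_⊆ above m w) (filter-all (m <?_) (All.map⁺ (All.tabulate λ {p} _ → above-m p)))
    (⊆-filter⁺ (m <?_) (m <?_) (λ { refl m< → m< }) τ))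
  where
  m<x : m < x
  m<x = ≤∧≢⇒< (All.lookup m≤w (Sublist.lookup τ (∈-map⁺ (substitute x y) 1∈ρ))) m≢x
  above-m : ∀ p → m < substitute x y p
  above-m 0             = <-trans m<x x<y
  above-m 1             = m<x
  above-m (suc (suc _)) = <-trans m<x x<y

unique⇒no-square : ∀ {x : ℕ} {w} → Unique w → ¬ x ∷ x ∷ [] ⊆ w
unique⇒no-square (_ ∷ !)  (_ ∷ʳ τ)   = unique⇒no-square ! τ
unique⇒no-square (x∉ ∷ _) (refl ∷ τ) = All.lookup x∉ (to∈ τ) refl

no-square⇒unique : ∀ {w : Word} → (∀ x → x ∈ w → ¬ x ∷ x ∷ [] ⊆ w) → Unique w
no-square⇒unique {[]}    _  = []
no-square⇒unique {x ∷ w} ¬□ =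
  All.tabulate (λ { y∈ refl → ¬□ x (here refl) (refl ∷ from∈ y∈) }) ∷
  no-square⇒unique λ y y∈ τ → ¬□ y (there y∈) (x ∷ʳ τ)

unique-insert : ∀ {m} u {u′} → All (m <_) u → All (m <_) u′ → Unique (u ++ m ∷ u′) ⇔ Unique (u ++ u′)
unique-insert {m} u {u′} m<u m<u′ = mk⇔
  (λ ! → tail (transport (shift m u u′) !))
  (λ ! → transport (↭-sym (shift m u u′)) (All.map <⇒≢ (All.++⁺ m<u m<u′) ∷ !))
  where
  transport : ∀ {v w : Word} → v ↭ w → Unique v → Unique w
  transport p = Unique-resp-↭ (setoid ℕ) (↭⇒↭ₛ p)
  tail : ∀ {x : ℕ} {w} → Unique (x ∷ w) → Unique w
  tail (_ ∷ !) = !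

disjoint-insertˡ : ∀ {m : ℕ} v {v′ u} → m ∉ u → Disjoint (v ++ m ∷ v′) u ⇔ Disjoint (v ++ v′) u
disjoint-insertˡ {m} v {v′} {u} m∉u = mk⇔
  (λ dis {_} (x∈ , x∈u) → dis (insert x∈ , x∈u))
  (λ dis {_} (x∈ , x∈u) → case-insert x∈ x∈u dis)
  where
  insert : ∀ {x} → x ∈ v ++ v′ → x ∈ v ++ m ∷ v′
  insert x∈ with ∈-++⁻ v x∈
  ... | inj₁ x∈v  = ∈-++⁺ˡ x∈v
  ... | inj₂ x∈v′ = ∈-++⁺ʳ v (there x∈v′)
  case-insert : ∀ {x} → x ∈ v ++ m ∷ v′ → x ∈ u → ¬ Disjoint (v ++ v′) u
  case-insert x∈ x∈u dis with ∈-++⁻ v x∈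
  ... | inj₁ x∈v          = dis (∈-++⁺ˡ x∈v , x∈u)
  ... | inj₂ (here refl)  = m∉u x∈u
  ... | inj₂ (there x∈v′) = dis (∈-++⁺ʳ v x∈v′ , x∈u)

disjoint-sym : ∀ {v u : Word} → Disjoint v u ⇔ Disjoint u v
disjoint-sym = mk⇔ (λ dis {_} (x , y) → dis (y , x)) (λ dis {_} (x , y) → dis (y , x))

-- Good splits of words ending in copies of `m`

module _ (m b : ℕ) where

  -- Every suffix except the empty one contains the final `m`, so only the last cut is good.
  #splits-unavoidable : ∀ (good : SplitTest) u → (∀ v → good v [] ≡ true) →
    (∀ v u → m ∈ u → good v u ≡ false) → #splits good (u ++ replicate (suc b) m) ≡ 1
  #splits-unavoidable good (x ∷ u) end bad =
    cong₂ _+_ (cong bit (bad [] _ (there (∈-++⁺ʳ u (here refl)))))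
      (#splits-unavoidable (good ∘ (x ∷_)) u (end ∘ (x ∷_)) (bad ∘ (x ∷_)))
  #splits-unavoidable good [] end bad = go b good end bad
    where
    go : ∀ b (good : SplitTest) → (∀ v → good v [] ≡ true) →
         (∀ v u → m ∈ u → good v u ≡ false) → #splits good (replicate (suc b) m) ≡ 1
    go zero    good end bad = cong₂ _+_ (cong bit (bad [] _ (here refl))) (cong bit (end _))
    go (suc b) good end bad = cong₂ _+_ (cong bit (bad [] _ (here refl)))
      (go b (good ∘ (m ∷_)) (end ∘ (m ∷_)) (bad ∘ (m ∷_)))

  -- Beyond the first `m` only the last cut is good. The good cuts up to the first `m` match the
  -- good splits of `w` whose prefix is no longer than `v`. Hence the j-th good split of `w` gets
  -- the label j + 1.
  #splits-spread : ∀ (good : SplitTest) w → All (m <_) w → (∀ v → good v [] ≡ true) →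
    (∀ v u → m ∈ v → m ∈ u → good v u ≡ false) →
    (∀ {v} u {u′} → All (m <_) v → All (m <_) u → All (m <_) u′ →
       good v (u ++ m ∷ u′ ++ replicate (suc b) m) ≡ good v (u ++ u′)) →
    map (λ (v , u) → #splits good (v ++ m ∷ u ++ replicate (suc b) m)) (splits good w) ≡
    applyUpTo (2 +_) (#splits good w)
  #splits-spread good [] [] end bad ins rewrite end [] =
    cong (_∷ []) (cong₂ _+_ (cong bit (trans (ins [] [] [] []) (end [])))
      (#splits-unavoidable (good ∘ (m ∷_)) [] (end ∘ (m ∷_)) λ v u → bad (m ∷ v) u (here refl)))
  #splits-spread good (x ∷ w) (m<x ∷ m<w) end bad ins with good [] (x ∷ w) in eq | later
    where
    g : SplitTest → Word × Word → ℕ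
    g good (v , u) = #splits good (v ++ m ∷ u ++ replicate (suc b) m)
    ss = splits (good ∘ (x ∷_)) w
    -- The cut before `x` is as good as in `x ∷ w`, so it contributes the same bit to the label of
    -- every later split.
    pointwise : ∀ {s} → s ∈ ss → g good (map₁ (x ∷_) s) ≡ bit (good [] (x ∷ w)) + g (good ∘ (x ∷_)) s
    pointwise {v , u} s∈ with refl , _ ← ∈-splits⁻ (good ∘ (x ∷_)) w s∈ =
      cong (λ c → bit c + g (good ∘ (x ∷_)) (v , u)) (ins {[]} (x ∷ v) [] (m<x ∷ All.++⁻ˡ v m<w) (All.++⁻ʳ v m<w))
    later : map (g good) (map (map₁ (x ∷_)) ss) ≡
            map (bit (good [] (x ∷ w)) +_) (applyUpTo (2 +_) (#splits (good ∘ (x ∷_)) w))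
    later = begin
      map (g good) (map (map₁ (x ∷_)) ss)                               ≡⟨ map-∘ ss ⟨
      map (g good ∘ map₁ (x ∷_)) ss                                     ≡⟨ map-cong-local (All.tabulate pointwise) ⟩
      map ((bit (good [] (x ∷ w)) +_) ∘ g (good ∘ (x ∷_))) ss           ≡⟨ map-∘ ss ⟩
      map (bit (good [] (x ∷ w)) +_) (map (g (good ∘ (x ∷_))) ss)       ≡⟨ cong (map _) (#splits-spread (good ∘ (x ∷_)) w m<w
                                                                             (end ∘ (x ∷_)) (λ v u → bad (x ∷ v) u ∘ there)
                                                                             (λ u m<v → ins u (m<x ∷ m<v))) ⟩
      map (bit (good [] (x ∷ w)) +_) (applyUpTo (2 +_) (#splits (good ∘ (x ∷_)) w)) ∎
      where open ≡-Reasoning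
  -- The split with empty prefix gets 1 + 1, from the cut before the first `m` and the last cut; all
  -- later labels grow by one.
  ... | true  | later′ = cong₂ _∷_
    (cong₂ _+_ (cong bit (trans (ins [] [] [] (m<x ∷ m<w)) eq))
      (#splits-unavoidable (good ∘ (m ∷_)) (x ∷ w) (end ∘ (m ∷_)) λ v u → bad (m ∷ v) u (here refl)))
    (trans later′ (map-applyUpTo (2 +_) suc _))
  ... | false | later′ = trans later′ (map-id _)

-- The class avoiding 112 and 2121

scheme-112-2121 : Scheme
scheme-112-2121 = record
  { Av   = λ w → Avoids₂ p112 w × Avoids₂ p2121 w
  ; good = good
  ; fill = fill
  ; Av-[] = (λ { _ _ _ () }) , (λ { _ _ _ () })
  ; Av-⊆  = λ τ (av₁ , av₂) → avoids₂-⊆ p112 τ av₁ , avoids₂-⊆ p2121 τ av₂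
  ; fill-zero = λ m u → ++-identityʳ u
  ; fill-↭ = λ m b u → ++-comm u (replicate b m)
  ; above-fill = above-fill
  ; Av-fill⁺ = λ b m<v m<u (av₁ , av₂) ok → let m≤w = bound b m<v m<u ; above≡ = sym (above-insert m<v (above-fill b m<u)) in
      avoids₂-above⁻ p112 (here refl) m≤w (subst (Avoids₂ p112) above≡ av₁) (no-112 b m<v m<u) ,
      avoids₂-above⁻ p2121 (there (here refl)) m≤w (subst (Avoids₂ p2121) above≡ av₂) (no-2121 b m<v m<u (does-true⇒ (disjoint? _≟_ _ _) ∘ ok))
  ; Av-fill⁻ = Av-fill⁻
  ; good-[] = refl
  ; good-insertˡ = λ {_} {v} _ _ m<u → does-⇔ (disjoint-insertˡ v (>⇒∉ m<u)) (disjoint? _≟_ _ _) (disjoint? _≟_ _ _)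
  ; good-insertʳ = λ {_} {_} {u} m<v _ _ → good-insertʳ {u = u} (>⇒∉ m<v)
  ; #splits-fill = λ {m} b {w} m<w → ↭-reflexive (#splits-spread m b good w m<w
      (λ v → dec-true (disjoint? _≟_ v []) λ { (_ , ()) })
      (λ v u m∈v m∈u → dec-false (disjoint? _≟_ v u) λ dis → dis (m∈v , m∈u))
      (λ {v} u {u′} m<v _ _ → trans (good-insertʳ {u = u} (>⇒∉ m<v))
        (does-⇔ (disjoint-++-replicate (suc b) u (>⇒∉ m<v)) (disjoint? _≟_ _ _) (disjoint? _≟_ _ _))))
  }
  where
  good : SplitTest
  good v u = does (disjoint? _≟_ v u)

  fill : ℕ → ℕ → Word → Word
  fill m b u = u ++ replicate b m

  above-fill : ∀ {m} b {u} → All (m <_) u → above m (fill m b u) ≡ u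
  above-fill {m} b {u} m<u = trans (filter-++ (m <?_) u (replicate b m))
    (trans (cong₂ _++_ (filter-all (m <?_) m<u) (above-none m b)) (++-identityʳ u))

  bound : ∀ {m} b {v u} → All (m <_) v → All (m <_) u → All (m ≤_) (v ++ m ∷ fill m b u)
  bound b m<v m<u = All.++⁺ (All.map <⇒≤ m<v) (≤-refl ∷ All.++⁺ (All.map <⇒≤ m<u) (All.replicate⁺ b ≤-refl))

  good-insertʳ : ∀ {m v u u′} → m ∉ v → good v (u ++ m ∷ u′) ≡ good v (u ++ u′)
  good-insertʳ {u = u} m∉v = does-⇔
    (disjoint-sym ⇔-∘ (disjoint-insertˡ u m∉v ⇔-∘ disjoint-sym)) (disjoint? _≟_ _ _) (disjoint? _≟_ _ _)

  disjoint-++-replicate : ∀ {m v} b u {u′} → m ∉ v → Disjoint v (u ++ u′ ++ replicate b m) ⇔ Disjoint v (u ++ u′)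
  disjoint-++-replicate {m} {v} b u {u′} m∉v rewrite sym (++-assoc u u′ (replicate b m)) = mk⇔
    (λ dis {_} (x∈v , x∈u) → dis (x∈v , ∈-++⁺ˡ x∈u))
    λ dis {_} (x∈v , x∈u) → extra x∈v dis (∈-++⁻ (u ++ u′) x∈u)
    where
    extra : ∀ {x} → x ∈ v → Disjoint v (u ++ u′) → ¬ (x ∈ u ++ u′ ⊎ x ∈ replicate b m)
    extra x∈v dis (inj₁ x∈u) = dis (x∈v , x∈u)
    extra x∈v dis (inj₂ x∈m) with refl ← ∈-replicate⁻ b x∈m = m∉v x∈v

  -- The second `m` can only come from the final block, where no `y` follows.
  no-112 : ∀ {m} b {v u} → All (m <_) v → All (m <_) u → ∀ y → m < y → ¬ m ∷ m ∷ y ∷ [] ⊆ v ++ m ∷ fill m b u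
  no-112 b {v} {u} m<v m<u y m<y τ = ∉-replicate b m<y
    (to∈ (∷ˡ⁻ (skip u (>⇒∉ m<u) (∷⁻ (skip v (>⇒∉ m<v) τ)))))

  -- If `y` is not in `v`, the occurrence starts in `u`, and after its first `m` only copies of `m`
  -- remain. If `y` is in `v`, the second `y` lies in `u`, against disjointness; for `b = 0` there
  -- is no place for the last `m`.
  no-2121 : ∀ {m} b {v u} → All (m <_) v → All (m <_) u → (1 ≤ b → Disjoint v u) →
            ∀ y → m < y → ¬ y ∷ m ∷ y ∷ m ∷ [] ⊆ v ++ m ∷ fill m b u
  no-2121 {m} b {v} {u} m<v m<u dis y m<y τ with _∈?_ _≟_ y v
  ... | no y∉v with skip v y∉v τ
  ...   | refl ∷ _  = <-irrefl refl m<y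
  ...   | .m ∷ʳ τ′ = ∉-replicate b m<y (to∈ (∷ˡ⁻ (skip u (>⇒∉ m<u) (∷ˡ⁻ τ′))))
  no-2121 {m} b {v} {u} m<v m<u dis y m<y τ | yes y∈v
    with b | ∷⁻ (skip v (>⇒∉ m<v) (∷ˡ⁻ τ))
  ... | zero  | τ′ = >⇒∉ m<u (subst (m ∈_) (++-identityʳ u) (to∈ (∷ˡ⁻ τ′)))
  ... | suc b | τ′ with ∈-++⁻ u (to∈ τ′)
  ...   | inj₁ y∈u = dis (s≤s z≤n) (y∈v , y∈u)
  ...   | inj₂ y∈m = ∉-replicate (suc b) m<y y∈m

  minimum-last : ∀ {m} r → All (m ≤_) r → (∀ y → m < y → ¬ m ∷ y ∷ [] ⊆ r) →
                 ∃ λ u → ∃ λ b → All (m <_) u × r ≡ fill m b u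
  minimum-last [] [] _ = [] , 0 , [] , refl
  minimum-last {m} (x ∷ r) (m≤x ∷ m≤r) ¬12 with m ≟ x
  -- Nothing larger may follow an `m`, so the rest of the word is constant.
  ... | yes refl = [] , suc (length r) , [] , cong (m ∷_) (constant r (All.tabulate λ y∈ →
    ≤-antisym (≮⇒≥ λ m<y → ¬12 _ m<y (refl ∷ from∈ y∈)) (All.lookup m≤r y∈)))
    where
    constant : ∀ r → All (_≡ m) r → r ≡ replicate (length r) m
    constant []      []         = refl
    constant (_ ∷ r) (refl ∷ c) = cong (m ∷_) (constant r c)
  ... | no m≢x with u , b , m<u , refl ← minimum-last r m≤r (λ y m<y τ → ¬12 y m<y (x ∷ʳ τ)) =
    x ∷ u , b , ≤∧≢⇒< m≤x m≢x ∷ m<u , refl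

  occurrences-fill : ∀ {m} b {u} → All (m <_) u → occurrences m (fill m b u) ≡ b
  occurrences-fill {m} b {u} m<u = trans (occurrences-++ m u (replicate b m))
    (cong₂ _+_ (occurrences-> m<u) (occurrences-replicate m b))

  Av-fill⁻ : ∀ {m v r} b → All (m <_) v → All (m ≤_) r → occurrences m r ≡ b →
    Avoids₂ p112 (v ++ m ∷ r) × Avoids₂ p2121 (v ++ m ∷ r) →
    ∃ λ u → All (m <_) u × r ≡ fill m b u × (1 ≤ b → good v u ≡ true)
  Av-fill⁻ {m} {v} {r} b m<v m≤r occ (av₁ , av₂)
    -- An `m` followed by a larger letter within `r` would form 112 with the `m` in front of `r`.
    with u , b′ , m<u , refl ← minimum-last r m≤r (λ y m<y τ → av₁ m y m<y (⊆-++⁺ (minimum v) (refl ∷ τ)))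
    with refl ← trans (sym (occurrences-fill b′ m<u)) occ =
    u , m<u , refl , disjoint b av₂
    where
    disjoint : ∀ b → Avoids₂ p2121 (v ++ m ∷ fill m b u) → 1 ≤ b → good v u ≡ true
    -- A common letter of `v` and `u`, with the first `m` between its two copies and a copy of `m`
    -- from the final block, forms 2121.
    disjoint (suc b) av₂ _ = dec-true (disjoint? _≟_ v u) λ (y∈v , y∈u) → av₂ m _ (All.lookup m<v y∈v)
      (⊆-++⁺ (from∈ y∈v) (refl ∷ ⊆-++⁺ (from∈ y∈u) (refl ∷ minimum _)))

-- The class avoiding 121 and 1122

scheme-121-1122 : Scheme
scheme-121-1122 = record
  { Av   = λ w → Avoids₂ p121 w × Avoids₂ p1122 w
  ; good = good
  ; fill = fill
  ; Av-[] = (λ { _ _ _ () }) , (λ { _ _ _ () })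
  ; Av-⊆  = λ τ (av₁ , av₂) → avoids₂-⊆ p121 τ av₁ , avoids₂-⊆ p1122 τ av₂
  ; fill-zero = λ m u → refl
  ; fill-↭ = λ m b u → ↭-refl
  ; above-fill = above-fill
  ; Av-fill⁺ = λ b m<v m<u (av₁ , av₂) ok → let m≤w = bound b m<v m<u ; above≡ = sym (above-insert m<v (above-fill b m<u)) in
      avoids₂-above⁻ p121 (here refl) m≤w (subst (Avoids₂ p121) above≡ av₁) (no-121 b m<v m<u) ,
      avoids₂-above⁻ p1122 (here refl) m≤w (subst (Avoids₂ p1122) above≡ av₂) (no-1122 b m<v m<u (does-true⇒ (unique? _≟_ _) ∘ ok))
  ; Av-fill⁻ = Av-fill⁻
  ; good-[] = refl
  ; good-insertˡ = λ _ _ _ → refl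
  ; good-insertʳ = λ {_} {_} {u} _ m<u m<u′ → does-⇔ (unique-insert u m<u m<u′) (unique? _≟_ _) (unique? _≟_ _)
  ; #splits-fill = #splits-fill
  }
  where
  good : SplitTest
  good v u = does (unique? _≟_ u)

  fill : ℕ → ℕ → Word → Word
  fill m b u = replicate b m ++ u

  above-fill : ∀ {m} b {u} → All (m <_) u → above m (fill m b u) ≡ u
  above-fill {m} b {u} m<u = trans (filter-++ (m <?_) (replicate b m) u)
    (cong₂ _++_ (above-none m b) (filter-all (m <?_) m<u))

  bound : ∀ {m} b {v u} → All (m <_) v → All (m <_) u → All (m ≤_) (v ++ m ∷ fill m b u)
  bound b m<v m<u = All.++⁺ (All.map <⇒≤ m<v) (≤-refl ∷ All.++⁺ (All.replicate⁺ b ≤-refl) (All.map <⇒≤ m<u))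

  no-121 : ∀ {m} b {v u} → All (m <_) v → All (m <_) u → ∀ y → m < y → ¬ m ∷ y ∷ m ∷ [] ⊆ v ++ m ∷ fill m b u
  no-121 {m} b {v} {u} m<v m<u y m<y τ = >⇒∉ m<u
    (to∈ (∷ˡ⁻ (skip (replicate b m) (∉-replicate b m<y) (∷⁻ (skip v (>⇒∉ m<v) τ)))))

  -- For `b = 0` there is no second `m`; otherwise both copies of `y` lie in `u`, whose letters are
  -- distinct.
  no-1122 : ∀ {m} b {v u} → All (m <_) v → All (m <_) u → (1 ≤ b → Unique u) →
            ∀ y → m < y → ¬ m ∷ m ∷ y ∷ y ∷ [] ⊆ v ++ m ∷ fill m b u
  no-1122 {m} b {v} {u} m<v m<u ! y m<y τ with b | ∷⁻ (skip v (>⇒∉ m<v) τ)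
  ... | zero  | τ′ = >⇒∉ m<u (to∈ τ′)
  ... | suc b | τ′ = unique⇒no-square (! (s≤s z≤n)) (skip (replicate (suc b) m) (∉-replicate (suc b) m<y) (∷ˡ⁻ τ′))

  minimum-first : ∀ {m} r → All (m ≤_) r → (∀ y → m < y → ¬ y ∷ m ∷ [] ⊆ r) →
                  ∃ λ u → ∃ λ b → All (m <_) u × r ≡ fill m b u
  minimum-first [] [] _ = [] , 0 , [] , refl
  minimum-first {m} (x ∷ r) (m≤x ∷ m≤r) ¬21 with m ≟ x
  ... | yes refl with u , b , m<u , refl ← minimum-first r m≤r (λ y m<y τ → ¬21 y m<y (x ∷ʳ τ)) =
    u , suc b , m<u , refl
  -- Once a larger letter has appeared, no `m` can follow, so the block of `m` is empty here.
  ... | no m≢x = x ∷ r , 0 , m<x ∷ All.tabulate (λ y∈ →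
    ≤∧≢⇒< (All.lookup m≤r y∈) λ { refl → ¬21 x m<x (refl ∷ from∈ y∈) }) , refl
    where m<x = ≤∧≢⇒< m≤x m≢x

  occurrences-fill : ∀ {m} b {u} → All (m <_) u → occurrences m (fill m b u) ≡ b
  occurrences-fill {m} b {u} m<u = trans (occurrences-++ m (replicate b m) u)
    (trans (cong₂ _+_ (occurrences-replicate m b) (occurrences-> m<u)) (+-identityʳ b))

  Av-fill⁻ : ∀ {m v r} b → All (m <_) v → All (m ≤_) r → occurrences m r ≡ b →
    Avoids₂ p121 (v ++ m ∷ r) × Avoids₂ p1122 (v ++ m ∷ r) →
    ∃ λ u → All (m <_) u × r ≡ fill m b u × (1 ≤ b → good v u ≡ true)
  Av-fill⁻ {m} {v} {r} b m<v m≤r occ (av₁ , av₂)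
    -- A larger letter followed by `m` within `r` would form 121 with the `m` in front of `r`.
    with u , b′ , m<u , refl ← minimum-first r m≤r (λ y m<y τ → av₁ m y m<y (⊆-++⁺ (minimum v) (refl ∷ τ)))
    with refl ← trans (sym (occurrences-fill b′ m<u)) occ =
    u , m<u , refl , unique b av₂
    where
    unique : ∀ b → Avoids₂ p1122 (v ++ m ∷ fill m b u) → 1 ≤ b → good v u ≡ true
    -- A repeated letter of `u`, preceded by the first two copies of `m`, forms 1122.
    unique (suc b) av₂ _ = dec-true (unique? _≟_ u) (no-square⇒unique λ y y∈u τ → av₂ m y (All.lookup m<u y∈u)
      (⊆-++⁺ (minimum v) (refl ∷ refl ∷ ⊆-++⁺ (minimum (replicate b m)) τ)))

  #splits-unique : ∀ {u} → Unique u → #splits good u ≡ suc (length u)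
  #splits-unique {[]}    _           = refl
  #splits-unique {x ∷ u} !@(_ ∷ u!) = cong₂ _+_ (cong bit (dec-true (unique? _≟_ (x ∷ u)) !)) (#splits-unique u!)

  square⇒bad : ∀ m u → m ∷ m ∷ [] ⊆ u → bit (does (unique? _≟_ u)) ≡ 0
  square⇒bad m u □ = cong bit (dec-false (unique? _≟_ u) λ ! → unique⇒no-square ! □)

  -- A suffix is good exactly if it has at most one `m`: these are `m ∷ u` and the `suc (length u)`
  -- suffixes of `u`.
  #splits-glue : ∀ {m} b v {u} → All (m <_) u → Unique u →
                 #splits good (v ++ m ∷ fill m (suc b) u) ≡ 2 + length u
  #splits-glue {m} b (x ∷ v) m<u ! =
    cong₂ _+_ (square⇒bad _ _ (x ∷ʳ ⊆-++⁺ (minimum v) (refl ∷ refl ∷ minimum _))) (#splits-glue b v m<u !)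
  #splits-glue {m} zero [] {u} m<u ! =
    cong₂ _+_ (square⇒bad m (m ∷ m ∷ u) (refl ∷ refl ∷ minimum _)) (#splits-unique (All.map <⇒≢ m<u ∷ !))
  #splits-glue {m} (suc b) [] {u} m<u ! =
    cong₂ _+_ (square⇒bad m (m ∷ m ∷ fill m (suc b) u) (refl ∷ refl ∷ minimum _)) (#splits-glue b [] m<u !)

  -- Suffixes of a duplicate-free word are duplicate-free, so the good suffixes are those of lengths
  -- c - 1, ..., 0, listed from the longest. The test ignores the prefix and thus stays the same in
  -- the recursion.
  suffix-lengths : ∀ w → map (λ (_ , u) → 2 + length u) (splits good w) ≡ applyDownFrom (2 +_) (#splits good w)
  suffix-lengths []      = refl
  suffix-lengths (x ∷ w) with does (unique? _≟_ (x ∷ w)) in eq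
  ... | false = trans (sym (map-∘ (splits good w))) (suffix-lengths w)
  ... | true with _ ∷ w! ← does-true⇒ (unique? _≟_ (x ∷ w)) eq = cong₂ _∷_ (cong (2 +_) (sym (#splits-unique w!)))
    (trans (sym (map-∘ (splits good w))) (suffix-lengths w))

  #splits-fill : ∀ {m} b {w} → All (m <_) w →
    map (λ (v , u) → #splits good (v ++ m ∷ fill m (suc b) u)) (splits good w) ↭ applyUpTo (2 +_) (#splits good w)
  #splits-fill {m} b {w} m<w = begin
    map (λ (v , u) → #splits good (v ++ m ∷ fill m (suc b) u)) (splits good w)  ≡⟨ map-cong-local (All.tabulate count) ⟩
    map (λ (_ , u) → 2 + length u) (splits good w)                              ≡⟨ suffix-lengths w ⟩
    applyDownFrom (2 +_) (#splits good w)                                       ≡⟨ reverse-applyUpTo (2 +_) _ ⟨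
    reverse (applyUpTo (2 +_) (#splits good w))                                 ↭⟨ ↭-reverse _ ⟩
    applyUpTo (2 +_) (#splits good w)                                           ∎
    where
    open PermutationReasoning
    count : ∀ {s} → s ∈ splits good w →
            #splits good (proj₁ s ++ m ∷ fill m (suc b) (proj₂ s)) ≡ 2 + length (proj₂ s)
    count {v , u} s∈ with refl , ok ← ∈-splits⁻ good w s∈ =
      #splits-glue b v (All.++⁻ʳ v m<w) (does-true⇒ (unique? _≟_ u) ok)

-- The equivalence of the two pattern sets

avoidsAll⇔ : ∀ {ρ ρ′} → (∀ {w} → w Avoids ρ ⇔ Avoids₂ ρ w) → (∀ {w} → w Avoids ρ′ ⇔ Avoids₂ ρ′ w) →
             ∀ w → AvoidsAll (ρ ∷ ρ′ ∷ []) w ⇔ (Avoids₂ ρ w × Avoids₂ ρ′ w)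
avoidsAll⇔ e e′ w = mk⇔
  (λ { (a ∷ a′ ∷ []) → Equivalence.to e a , Equivalence.to e′ a′ })
  (λ (a , a′) → Equivalence.from e a ∷ Equivalence.from e′ a′ ∷ [])

theorem2p13 : ((1 ∷ 1 ∷ 2 ∷ []) ∷ (2 ∷ 1 ∷ 2 ∷ 1 ∷ []) ∷ [])
    ∼ ((1 ∷ 2 ∷ 1 ∷ []) ∷ (1 ∷ 1 ∷ 2 ∷ 2 ∷ []) ∷ [])
theorem2p13 S = trans
  (Generation.av≡profile scheme-112-2121 (p112 ∷ p2121 ∷ [])
    (avoidsAll⇔ (avoids⇔avoids₂ (one ∷ one ∷ two ∷ []) (here refl) (there (there (here refl))))
                (avoids⇔avoids₂ (two ∷ one ∷ two ∷ one ∷ []) (there (here refl)) (here refl))) S)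
  (sym (Generation.av≡profile scheme-121-1122 (p121 ∷ p1122 ∷ [])
    (avoidsAll⇔ (avoids⇔avoids₂ (one ∷ two ∷ one ∷ []) (here refl) (there (here refl)))
                (avoids⇔avoids₂ (one ∷ one ∷ two ∷ two ∷ []) (here refl) (there (there (here refl))))) S))
  where
  one = inj₁ refl
  two = inj₂ refl
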